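{- Let $\mathcal{C}\subseteq 2^{[n]}$ be a closed convex code. Let $\mathcal{D}$ be a downward-closed subset of $\Delta(\mathcal{C})\setminus \mathcal{C}$. Then $\mathcal{C}\cup\mathcal{D}$ is closed convex, and moreover $$\operatorname{cdim}(\mathcal{C}\cup\mathcal{D}) \le \operatorname{cdim}(\mathcal{C}) + 2.$$
   Context: Write $[n]=\{1,\ldots,n\}$. A code is a set $\mathcal{C}\subseteq 2^{[n]}$. For an ordered (indexed) collection $\mathcal{U} = \{U_1, \ldots, U_n\}$ of sets in $\mathbb{R}^d$, its code is $$\operatorname{code}(\mathcal{U}) = \{\sigma\subseteq [n] \mid \text{there exists } p\in \mathbb{R}^d \text{ such that for all } i\in[n],\ p\in U_i \text{ if and only if } i\in\sigma\},$$ and $\mathcal{U}$ is called a realization of $\operatorname{code}(\mathcal{U})$. By standing convention, all sets in realizations are bounded and $d\ge 1$ (so every realizable code contains $\emptyset$). A code is closed convex if for some $d$ it has a realization in $\mathbb{R}^d$ in which every set is closed and convex. $\operatorname{cdim}(\mathcal{C})$ is the minimum such $d$ (with the minimum over the empty set being $\infty$). $\Delta(\mathcal{C}) = \{\sigma\subseteq [n]\mid \sigma\subseteq c\text{ for some }c\in \mathcal{C}\}$ is the abstract simplicial complex generated by $\mathcal{C}$. A downward-closed set in a poset is a set of elements which contains every element of the poset that is less than some element of the set; here the poset is $\Delta(\mathcal{C})\setminus\mathcal{C}$ ordered by inclusion, i.e. if $\tau\in\mathcal{D}$ and $\rho\subseteq\tau$ with $\rho\in\Delta(\mathcal{C})\setminus\mathcal{C}$,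 then $\rho\in\mathcal{D}$. -}

module Defs where

open import Algebra.Core using (Op₁; Op₂)
import Algebra.Definitions as AlgebraDefinitions
open import Algebra.Structures using (IsCommutativeRing)
open import Axiom.ExcludedMiddle using (ExcludedMiddle)
open import Data.Empty using (⊥-elim)
open import Data.Fin.Base using (Fin)
import Data.Fin.Subset as Subset
open import Data.Fin.Subset using (Subset)
open import Data.Nat.Base as ℕ using (ℕ; zero; suc)
import Data.Nat.Properties as ℕ
open import Data.Product.Base using (∃; _×_; _,_; proj₁)
open import Data.Sum.Base using (_⊎_; inj₁; inj₂)
open import Data.Vec.Functional using (Vector)
open import Function.Bundles using (_⇔_)
open import Level using (0ℓ) renaming (suc to lsuc)
open import Relation.Binary.Core using (Rel)
open import Relation.Binary.Structures using (IsTotalOrder)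
open import Relation.Binary.PropositionalEquality.Core using (refl)
import Relation.Binary.Construct.NonStrictToStrict as Strict
import Relation.Binary.Construct.Add.Supremum.NonStrict as AddSupremum
open import Relation.Nullary using (¬_; yes; no)
open import Relation.Nullary.Construct.Add.Supremum using (_⁺; ⊤⁺; [_])
open import Relation.Unary using (Pred; _∈_; _⊆_; _≐_; _∖_; ∁; Satisfiable)

-- The library has no real numbers.  They are axiomatised as a
-- Dedekind-complete ordered field, which is unique up to isomorphism.
record CompleteOrderedField : Set₁ where
  infix  8 -_
  infixl 7 _*_
  infixl 6 _+_ _-_
  infix  4 _≈_ _≉_ _≤_ _<_
  field
    Carrier           : Set
    _≈_               : Rel Carrier 0ℓ
    _≤_               : Rel Carrier 0ℓ
    _+_ _*_           : Op₂ Carrier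
    -_                : Op₁ Carrier
    0# 1#             : Carrier
    isCommutativeRing : IsCommutativeRing _≈_ _+_ _*_ -_ 0# 1#
    isTotalOrder      : IsTotalOrder _≈_ _≤_

  _≉_ : Rel Carrier 0ℓ
  x ≉ y = ¬ (x ≈ y)

  _<_ : Rel Carrier 0ℓ
  _<_ = Strict._<_ _≈_ _≤_

  _-_ : Op₂ Carrier
  x - y = x + - y

  open AlgebraDefinitions _≈_ using (Invertible)

  IsUpperBound : Pred Carrier 0ℓ → Pred Carrier 0ℓ
  IsUpperBound S b = ∀ x → x ∈ S → x ≤ b

  IsSupremum : Pred Carrier 0ℓ → Pred Carrier 0ℓ
  IsSupremum S s = IsUpperBound S s × (∀ b → IsUpperBound S b → s ≤ b)

  field
    0≉1          : 0# ≉ 1#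
    invertible   : ∀ x → x ≉ 0# → Invertible 1# _*_ x
    +-monoʳ-≤    : ∀ x {y z} → y ≤ z → x + y ≤ x + z
    *-nonNeg     : ∀ {x y} → 0# ≤ x → 0# ≤ y → 0# ≤ x * y
    completeness : ∀ (S : Pred Carrier 0ℓ) → Satisfiable S →
                   Satisfiable (IsUpperBound S) → Satisfiable (IsSupremum S)

module _ (ℝ : CompleteOrderedField) where
  open CompleteOrderedField ℝ

  Point : ℕ → Set
  Point d = Vector Carrier d

  PointSet : ℕ → Set₁
  PointSet d = Pred (Point d) 0ℓ

  IsBounded : ∀ {d} → PointSet d → Set
  IsBounded U = ∃ λ b → ∀ x → x ∈ U → ∀ i → (- b ≤ x i) × (x i ≤ b)

  IsConvex : ∀ {d} → PointSet d → Set
  IsConvex U = ∀ x y → x ∈ U → y ∈ U → ∀ t → 0# ≤ t → t ≤ 1# →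
               (λ i → (1# - t) * x i + t * y i) ∈ U

  -- Balls of the maximum norm: they generate the usual topology.
  Ball : ∀ {d} → Point d → Carrier → PointSet d
  Ball x ε y = ∀ i → (- ε < y i - x i) × (y i - x i < ε)

  IsOpen : ∀ {d} → PointSet d → Set
  IsOpen U = ∀ x → x ∈ U → ∃ λ ε → (0# < ε) × (Ball x ε ⊆ U)

  -- The ball around x contains every point coordinatewise ≈ to x, so,
  -- classically, closed sets are invariant under that equality.  Hence
  -- PointSet needs no separate extensionality condition.
  IsClosed : ∀ {d} → PointSet d → Set
  IsClosed U = IsOpen (∁ U)

Code : ℕ → Set₁
Code n = Pred (Subset n) 0ℓ

code : ∀ (ℝ : CompleteOrderedField) {n d} → (Fin n → PointSet ℝ d) → Code n
code ℝ {d = d} U σ = ∃ λ (p : Point ℝ d) → ∀ i → (p ∈ U i) ⇔ (i Subset.∈ σ)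

record ClosedConvexRealization (ℝ : CompleteOrderedField) {n} (C : Code n)
                               (d : ℕ) : Set₁ where
  field
    1≤d       : 1 ℕ.≤ d
    sets      : Fin n → PointSet ℝ d
    bounded   : ∀ i → IsBounded ℝ (sets i)
    closed    : ∀ i → IsClosed ℝ (sets i)
    convex    : ∀ i → IsConvex ℝ (sets i)
    code-sets : code ℝ sets ≐ C

IsClosedConvex : ∀ (ℝ : CompleteOrderedField) {n} → Code n → Set₁
IsClosedConvex ℝ C = ∃ λ d → ClosedConvexRealization ℝ C d

ℕ∞ : Set
ℕ∞ = ℕ ⁺

infix  4 _≤∞_
infixl 6 _+∞_

_≤∞_ : Rel ℕ∞ 0ℓ
_≤∞_ = AddSupremum._≤⁺_ ℕ._≤_

_+∞_ : ℕ∞ → ℕ → ℕ∞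
[ m ] +∞ k = [ m ℕ.+ k ]
⊤⁺    +∞ k = ⊤⁺

IsMinimum : Pred ℕ (lsuc 0ℓ) → Pred ℕ (lsuc 0ℓ)
IsMinimum P m = P m × (∀ k → P k → m ℕ.≤ k)

module _ (em : ExcludedMiddle (lsuc 0ℓ)) where

  private
    search : ∀ (P : Pred ℕ (lsuc 0ℓ)) n →
             ∃ (IsMinimum P) ⊎ (∀ k → k ℕ.< n → ¬ P k)
    search P zero    = inj₂ λ _ ()
    search P (suc n) with search P n
    ... | inj₁ found = inj₁ found
    ... | inj₂ none  with em {P n}
    ...   | yes p = inj₁ (n , p , λ k pk → ℕ.≮⇒≥ λ k<n → none k k<n pk)
    ...   | no ¬p = inj₂ none′
      where
      none′ : ∀ k → k ℕ.< suc n → ¬ P k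
      none′ k k<1+n with ℕ.m<1+n⇒m<n∨m≡n k<1+n
      ... | inj₁ k<n  = none k k<n
      ... | inj₂ refl = ¬p

  minimum : ∀ (P : Pred ℕ (lsuc 0ℓ)) → Satisfiable P → ∃ (IsMinimum P)
  minimum P (n , p) with search P (suc n)
  ... | inj₁ found = found
  ... | inj₂ none  = ⊥-elim (none n ℕ.≤-refl p)

  min∞ : Pred ℕ (lsuc 0ℓ) → ℕ∞
  min∞ P with em {Satisfiable P}
  ... | yes ∃P = [ proj₁ (minimum P ∃P) ]
  ... | no  _  = ⊤⁺

  cdim : ∀ (ℝ : CompleteOrderedField) {n} → Code n → ℕ∞
  cdim ℝ C = min∞ (ClosedConvexRealization ℝ C)

Δ : ∀ {n} → Code n → Code n
Δ C σ = ∃ λ c → (c ∈ C) × (σ Subset.⊆ c)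

-- D is a downward-closed set in the poset P, ordered by inclusion.
record IsDownwardClosedIn {n} (P D : Code n) : Set where
  field
    subset : D ⊆ P
    down   : ∀ {τ ρ} → τ ∈ D → ρ ∈ P → ρ Subset.⊆ τ → ρ ∈ D

module Submission where

open import Defs
open import Axiom.ExcludedMiddle using (ExcludedMiddle)
open import Data.Nat.Base using (ℕ)
open import Data.Product.Base using (_×_)
open import Level using (0ℓ; suc)
open import Relation.Unary using (_∪_; _∖_)

open import Algebra.Bundles using (CommutativeRing)
import Algebra.Properties.Ring as RingProperties
import Algebra.Properties.AbelianGroup as AbelianGroupProperties
import Algebra.Properties.Semiring.Mult as SemiringMultiplication
import Algebra.Solver.Ring.NaturalCoefficients.Default as NatSolver
open import Data.Bool.Base using (true; false)
open import Data.Empty using (⊥; ⊥-elim)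
open import Data.Fin.Base as Fin using (Fin; toℕ; combine)
open import Data.Fin.Properties using (combine-injective; 2↔Bool; toℕ-injective)
open import Data.Fin.Subset as Subset using (Subset)
open import Data.Fin.Subset.Properties as Subset using (Empty-unique; ⊆-antisym)
import Data.Nat.Base as ℕ
import Data.Nat.Properties as ℕ
open import Data.Product.Base using (∃; _,_; proj₁; proj₂)
open import Data.Sum.Base using (inj₁; inj₂)
import Data.Vec.Base as Vec
open import Data.Vec.Functional using (_∷_; tail)
open import Data.Vec.Properties using (lookup∘tabulate; []=⇒lookup; lookup⇒[]=)
open import Function.Base using (_∘_)
open import Function.Bundles using (_⇔_; mk⇔; Equivalence; Injection; Inverse)
open import Function.Properties.Inverse using (↔-sym; ↔⇒↣)
open import Level using (lift; lower)
open import Relation.Binary.Bundles using (TotalOrder)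
import Relation.Binary.Construct.Add.Supremum.NonStrict as AddSupremum
import Relation.Binary.Properties.TotalOrder as TotalOrderProperties
import Relation.Binary.Reasoning.PartialOrder as PosetReasoning
open import Relation.Binary.Definitions using (tri<; tri≈; tri>)
open import Relation.Binary.PropositionalEquality as ≡ using (_≡_; _≢_)
open import Relation.Nullary using (¬_; Dec; yes; no; does)
open import Relation.Nullary.Decidable using (map′; decidable-stable; dec-true; dec-false)
open import Relation.Unary using (Pred; _∈_; _⊆_; _⊢_; ⋂)
import Relation.Unary as Pred

-- Given a realization U of C in ℝᵈ, put V i = U i × P i, where P i is a
-- region above the parabola y = x² in the plane (bounded by a box).  Each
-- τ ∈ D gets a vertex on the parabola and a small cap at it, cut off by a
-- line; the cap is removed from P i exactly when i ∉ τ.  The caps are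
-- pairwise disjoint.  Outside all caps one sees the codewords of C, and in
-- the cap of τ the sets σ ∩ τ with σ ∈ C: these lie in C or, D being
-- downward closed, in D, and τ itself is among them because τ ∈ Δ C.
-- Outside the framed region one sees ∅, which is in C by boundedness.

-- Arithmetic of ordered fields.

module OrderedField (ℝ : CompleteOrderedField) where
  open CompleteOrderedField ℝ public

  commutativeRing : CommutativeRing 0ℓ 0ℓ
  commutativeRing = record { isCommutativeRing = isCommutativeRing }

  totalOrder : TotalOrder 0ℓ 0ℓ 0ℓ
  totalOrder = record { isTotalOrder = isTotalOrder }

  open CommutativeRing commutativeRing public
    using ( refl; sym; trans; +-cong; +-congˡ; +-congʳ; *-cong; *-congˡ; *-congʳ; -‿cong
          ; +-comm; +-assoc; +-identityˡ; +-identityʳ; -‿inverseˡ; -‿inverseʳ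
          ; *-identityˡ; *-identityʳ; zeroˡ; zeroʳ; ring; semiring
          ; commutativeSemiring; +-abelianGroup)
  open TotalOrder totalOrder public
    using (total; poset)
    renaming (refl to ≤-refl; reflexive to ≤-reflexive; trans to ≤-trans; antisym to ≤-antisym)
  open TotalOrderProperties totalOrder public using (≰⇒≥; ≰⇒>; <⇒≱)
  open RingProperties ring public using (-‿distribˡ-*; -‿distribʳ-*; -‿involutive; -0#≈0#; -1*x≈-x)
  open AbelianGroupProperties +-abelianGroup public using (xyx⁻¹≈y)
  open NatSolver commutativeSemiring public using (solve; _:+_; _:*_; _:=_)
  open PosetReasoning poset public

  x+[y-x]≈y : ∀ x y → x + (y - x) ≈ y
  x+[y-x]≈y x y = trans (sym (+-assoc x y (- x))) (xyx⁻¹≈y x y)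

  +-monoˡ-≤ : ∀ z {x y} → x ≤ y → x + z ≤ y + z
  +-monoˡ-≤ z {x} {y} x≤y = begin
    x + z ≈⟨ +-comm x z ⟩
    z + x ≤⟨ +-monoʳ-≤ z x≤y ⟩
    z + y ≈⟨ +-comm z y ⟩
    y + z ∎

  +-mono-≤ : ∀ {x y u v} → x ≤ y → u ≤ v → x + u ≤ y + v
  +-mono-≤ {y = y} {u} x≤y u≤v = ≤-trans (+-monoˡ-≤ u x≤y) (+-monoʳ-≤ y u≤v)

  +-cancelˡ-≤ : ∀ x {y z} → x + y ≤ x + z → y ≤ z
  +-cancelˡ-≤ x {y} {z} le = begin
    y              ≈⟨ -x+[x+y]≈y y ⟨
    - x + (x + y)  ≤⟨ +-monoʳ-≤ (- x) le ⟩
    - x + (x + z)  ≈⟨ -x+[x+y]≈y z ⟩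
    z              ∎
    where
    -x+[x+y]≈y : ∀ y → - x + (x + y) ≈ y
    -x+[x+y]≈y y = trans (sym (+-assoc (- x) x y)) (trans (+-congʳ (-‿inverseˡ x)) (+-identityˡ y))

  x≤x+y : ∀ {x y} → 0# ≤ y → x ≤ x + y
  x≤x+y {x} {y} 0≤y = begin
    x      ≈⟨ +-identityʳ x ⟨
    x + 0# ≤⟨ +-monoʳ-≤ x 0≤y ⟩
    x + y  ∎

  x≤y+x : ∀ {x y} → 0# ≤ y → x ≤ y + x
  x≤y+x {x} {y} 0≤y = ≤-trans (x≤x+y 0≤y) (≤-reflexive (+-comm x y))

  +-nonNeg : ∀ {x y} → 0# ≤ x → 0# ≤ y → 0# ≤ x + y
  +-nonNeg 0≤x 0≤y = ≤-trans 0≤x (x≤x+y 0≤y)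

  x≤y⇒0≤y-x : ∀ {x y} → x ≤ y → 0# ≤ y - x
  x≤y⇒0≤y-x {x} {y} x≤y = +-cancelˡ-≤ x (begin
    x + 0#      ≈⟨ +-identityʳ x ⟩
    x           ≤⟨ x≤y ⟩
    y           ≈⟨ x+[y-x]≈y x y ⟨
    x + (y - x) ∎)

  neg-antimono-≤ : ∀ {x y} → x ≤ y → - y ≤ - x
  neg-antimono-≤ {x} {y} x≤y = +-cancelˡ-≤ x (begin
    x - y ≤⟨ +-monoˡ-≤ (- y) x≤y ⟩
    y - y ≈⟨ -‿inverseʳ y ⟩
    0#    ≈⟨ -‿inverseʳ x ⟨
    x - x ∎)

  -x≤y⇒-y≤x : ∀ {x y} → - x ≤ y → - y ≤ x
  -x≤y⇒-y≤x {x} {y} -x≤y = ≤-trans (neg-antimono-≤ -x≤y) (≤-reflexive (-‿involutive x))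

  neg-cancel-≤ : ∀ {x y} → - x ≤ - y → y ≤ x
  neg-cancel-≤ {x} {y} le = ≤-trans (≤-reflexive (sym (-‿involutive y))) (-x≤y⇒-y≤x le)

  nonPos⇒neg-nonNeg : ∀ {x} → x ≤ 0# → 0# ≤ - x
  nonPos⇒neg-nonNeg {x} x≤0 =
    ≤-trans (x≤y⇒0≤y-x x≤0) (≤-reflexive (+-identityˡ (- x)))

  nonNeg⇒neg-nonPos : ∀ {x} → 0# ≤ x → - x ≤ 0#
  nonNeg⇒neg-nonPos 0≤x = ≤-trans (neg-antimono-≤ 0≤x) (≤-reflexive -0#≈0#)

  *-monoˡ-≤-nonNeg : ∀ {c x y} → 0# ≤ c → x ≤ y → c * x ≤ c * y
  *-monoˡ-≤-nonNeg {c} {x} {y} 0≤c x≤y = begin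
    c * x               ≤⟨ x≤x+y (*-nonNeg 0≤c (x≤y⇒0≤y-x x≤y)) ⟩
    c * x + c * (y - x) ≈⟨ solve 3 (λ c x z → c :* x :+ c :* z := c :* (x :+ z)) refl c x (y - x) ⟩
    c * (x + (y - x))   ≈⟨ *-congˡ (x+[y-x]≈y x y) ⟩
    c * y               ∎

  -x*-y≈x*y : ∀ x y → - x * - y ≈ x * y
  -x*-y≈x*y x y = begin-equality
    - x * - y   ≈⟨ -‿distribˡ-* x (- y) ⟨
    - (x * - y) ≈⟨ -‿cong (-‿distribʳ-* x y) ⟨
    - - (x * y) ≈⟨ -‿involutive (x * y) ⟩
    x * y       ∎

  square-nonNeg : ∀ x → 0# ≤ x * x
  square-nonNeg x with total 0# x
  ... | inj₁ 0≤x = *-nonNeg 0≤x 0≤x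
  ... | inj₂ x≤0 = ≤-trans (*-nonNeg 0≤-x 0≤-x) (≤-reflexive (-x*-y≈x*y x x))
    where 0≤-x = nonPos⇒neg-nonNeg x≤0

  0≤1 : 0# ≤ 1#
  0≤1 = ≤-trans (square-nonNeg 1#) (≤-reflexive (*-identityˡ 1#))

  1≰0 : ¬ (1# ≤ 0#)
  1≰0 1≤0 = 0≉1 (≤-antisym 0≤1 1≤0)

  1+x≰x : ∀ {x} → ¬ (1# + x ≤ x)
  1+x≰x {x} le = 1≰0 (+-cancelˡ-≤ x (begin
    x + 1# ≈⟨ +-comm x 1# ⟩
    1# + x ≤⟨ le ⟩
    x      ≈⟨ +-identityʳ x ⟨
    x + 0# ∎))

  1≤x⇒1≤x² : ∀ {x} → 1# ≤ x → 1# ≤ x * x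
  1≤x⇒1≤x² {x} 1≤x = begin
    1#     ≤⟨ 1≤x ⟩
    x      ≈⟨ *-identityʳ x ⟨
    x * 1# ≤⟨ *-monoˡ-≤-nonNeg (≤-trans 0≤1 1≤x) 1≤x ⟩
    x * x  ∎

  divide-positive : ∀ {k δ} → 0# < k → 0# < δ → ∃ λ ε → (0# < ε) × (k * ε ≈ δ)
  divide-positive {k} {δ} (0≤k , 0≉k) (0≤δ , 0≉δ)
    with k⁻¹ , _ , kk⁻¹≈1 ← invertible k (0≉k ∘ sym) =
    k⁻¹ * δ , (*-nonNeg 0≤k⁻¹ 0≤δ , 0≉ε) , kε≈δ
    where
    0≤k⁻¹ : 0# ≤ k⁻¹
    0≤k⁻¹ with total 0# k⁻¹
    ... | inj₁ 0≤k⁻¹ = 0≤k⁻¹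
    ... | inj₂ k⁻¹≤0 = ⊥-elim (1≰0 (begin
      1#      ≈⟨ kk⁻¹≈1 ⟨
      k * k⁻¹ ≤⟨ *-monoˡ-≤-nonNeg 0≤k k⁻¹≤0 ⟩
      k * 0#  ≈⟨ zeroʳ k ⟩
      0#      ∎))
    kε≈δ : k * (k⁻¹ * δ) ≈ δ
    kε≈δ = begin-equality
      k * (k⁻¹ * δ) ≈⟨ solve 3 (λ k l d → k :* (l :* d) := (k :* l) :* d) refl k k⁻¹ δ ⟩
      k * k⁻¹ * δ   ≈⟨ *-congʳ kk⁻¹≈1 ⟩
      1# * δ        ≈⟨ *-identityˡ δ ⟩
      δ             ∎
    0≉ε : 0# ≉ k⁻¹ * δ
    0≉ε 0≈ε = 0≉δ (trans (sym (zeroʳ k)) (trans (*-congˡ 0≈ε) kε≈δ))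

  -- The constant is the absolute value of `α`, so one estimate serves coefficients of both signs in
  -- `halfSpace-closedConvex`.
  lipschitz : ∀ α → ∃ λ a → (0# ≤ a) ×
              (∀ {ε x} → - ε ≤ x → x ≤ ε → α * x ≤ a * ε)
  lipschitz α with total 0# α
  ... | inj₁ 0≤α = α , 0≤α , λ _ x≤ε → *-monoˡ-≤-nonNeg 0≤α x≤ε
  ... | inj₂ α≤0 = - α , 0≤-α , λ {ε} {x} -ε≤x _ → begin
    α * x     ≈⟨ -x*-y≈x*y α x ⟨
    - α * - x ≤⟨ *-monoˡ-≤-nonNeg 0≤-α (-x≤y⇒-y≤x -ε≤x) ⟩
    - α * ε   ∎
    where 0≤-α = nonPos⇒neg-nonNeg α≤0

  upper-bound : ∀ x y → ∃ λ z → (x ≤ z) × (y ≤ z)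
  upper-bound x y with total x y
  ... | inj₁ x≤y = y , x≤y , ≤-refl
  ... | inj₂ y≤x = x , ≤-refl , y≤x

  finite-bound : ∀ {k} (f : Fin k → Carrier) → ∃ λ b → ∀ j → f j ≤ b
  finite-bound {ℕ.zero}  f = 0# , λ ()
  finite-bound {ℕ.suc k} f with finite-bound (f ∘ Fin.suc)
  ... | b , f≤b with total (f Fin.zero) b
  ...   | inj₁ f₀≤b = b , λ { Fin.zero → f₀≤b ; (Fin.suc j) → f≤b j }
  ...   | inj₂ b≤f₀ = f Fin.zero , λ { Fin.zero → ≤-refl ; (Fin.suc j) → ≤-trans (f≤b j) b≤f₀ }

-- Closed convex sets in the product of the plane with ℝᵈ.

module Geometry (em : ExcludedMiddle (suc 0ℓ)) (ℝ : CompleteOrderedField) where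
  open OrderedField ℝ

  -- `em` lives one universe up; lifting `A` brings it down to `Set`.
  decide : {A : Set} → Dec A
  decide = map′ lower lift em

  ¬∀⇒∃¬ : ∀ {I : Set} {P : I → Set} → ¬ (∀ i → P i) → ∃ λ i → ¬ P i
  ¬∀⇒∃¬ ¬∀ = decidable-stable decide λ ¬∃ →
    ¬∀ λ i → decidable-stable decide λ ¬Pi → ¬∃ (i , ¬Pi)

  0th 1st : ∀ {d} → Point ℝ (2 ℕ.+ d) → Carrier
  0th z = z Fin.zero
  1st z = z (Fin.suc Fin.zero)

  tail² : ∀ {d} → Point ℝ (2 ℕ.+ d) → Point ℝ d
  tail² z = tail (tail z)

  IsClosedConvexSet : ∀ {d} → PointSet ℝ d → Set
  IsClosedConvexSet P = IsClosed ℝ P × IsConvex ℝ P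

  ∩-closedConvex : ∀ {d} {P Q : PointSet ℝ d} → IsClosedConvexSet P → IsClosedConvexSet Q →
                   IsClosedConvexSet (P Pred.∩ Q)
  ∩-closedConvex {P = P} {Q} (P-closed , P-convex) (Q-closed , Q-convex) = closed , convex
    where
    closed : IsClosed ℝ (P Pred.∩ Q)
    closed x x∉P∩Q with decide {x ∈ P}
    ... | no x∉P with ε , 0<ε , ball ← P-closed x x∉P = ε , 0<ε , λ b → ball b ∘ proj₁
    ... | yes x∈P with ε , 0<ε , ball ← Q-closed x (λ x∈Q → x∉P∩Q (x∈P , x∈Q)) =
      ε , 0<ε , λ b → ball b ∘ proj₂
    convex : IsConvex ℝ (P Pred.∩ Q)
    convex x y (x∈P , x∈Q) (y∈P , y∈Q) t 0≤t t≤1 =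
      P-convex x y x∈P y∈P t 0≤t t≤1 , Q-convex x y x∈Q y∈Q t 0≤t t≤1

  -- A point outside the intersection is outside one member, and a ball avoiding that member avoids
  -- the intersection. Infinite families such as `aboveParabola` are therefore covered.
  ⋂-closedConvex : ∀ {d} {I : Set} {P : I → PointSet ℝ d} → (∀ i → IsClosedConvexSet (P i)) →
                   IsClosedConvexSet (⋂ I P)
  ⋂-closedConvex {I = I} {P} P-cc = closed , convex
    where
    closed : IsClosed ℝ (⋂ I P)
    closed x x∉⋂ with i , x∉Pi ← ¬∀⇒∃¬ x∉⋂ with ε , 0<ε , ball ← proj₁ (P-cc i) x x∉Pi =
      ε , 0<ε , λ b y∈⋂ → ball b (y∈⋂ i)
    convex : IsConvex ℝ (⋂ I P)
    convex x y x∈⋂ y∈⋂ t 0≤t t≤1 i = proj₂ (P-cc i) x y (x∈⋂ i) (y∈⋂ i) t 0≤t t≤1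

  -- Dropping coordinates maps a maximum-norm ball into the ball of the same radius and commutes
  -- definitionally with convex combinations.
  tail²-closedConvex : ∀ {d} {P : PointSet ℝ d} → IsClosedConvexSet P →
                       IsClosedConvexSet (tail² ⊢ P)
  tail²-closedConvex {P = P} (P-closed , P-convex) =
    closed , λ x y → P-convex (tail² x) (tail² y)
    where
    closed : IsClosed ℝ (tail² ⊢ P)
    closed x x∉ with ε , 0<ε , ball ← P-closed (tail² x) x∉ =
      ε , 0<ε , λ b → ball (λ i → b (Fin.suc (Fin.suc i)))

  affine : ∀ {d} → Carrier → Carrier → Carrier → Point ℝ (2 ℕ.+ d) → Carrier
  affine α β κ z = α * 0th z + β * 1st z + κ

  -- Keeping the level `γ` apart from `κ` lets parallel half-spaces share one `affine` map, as the
  -- two levels of `aboveTangent` do.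
  halfSpace : ∀ {d} → Carrier → Carrier → Carrier → Carrier → PointSet ℝ (2 ℕ.+ d)
  halfSpace γ α β κ z = γ ≤ affine α β κ z

  halfSpace-closedConvex : ∀ {d} γ α β κ → IsClosedConvexSet (halfSpace {d} γ α β κ)
  halfSpace-closedConvex {d} γ α β κ = closed , convex
    where
    f : Point ℝ (2 ℕ.+ d) → Carrier
    f = affine α β κ

    closed : IsClosed ℝ (halfSpace γ α β κ)
    closed z γ≰fz
      with fz≤γ , fz≉γ ← ≰⇒> γ≰fz
      with a , 0≤a , a-bound ← lipschitz α
      with b , 0≤b , b-bound ← lipschitz β
      -- The radius is the gap `γ - f z` divided by `1# + (a + b)`. On the ball `f` grows by at most
      -- `(a + b) * ε`, which falls short of the gap by `ε`; the summand `1#` also keeps the divisor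
      -- positive when `a` and `b` vanish.
      with ε , 0<ε , kε≈δ ← divide-positive {1# + (a + b)} {γ - f z}
             (≤-trans 0≤1 (x≤x+y (+-nonNeg 0≤a 0≤b)) ,
              λ 0≈ → 1≰0 (≤-trans (x≤x+y (+-nonNeg 0≤a 0≤b)) (≤-reflexive (sym 0≈))))
             (x≤y⇒0≤y-x fz≤γ ,
              λ 0≈δ → fz≉γ (trans (trans (sym (+-identityʳ (f z))) (+-congˡ 0≈δ)) (x+[y-x]≈y (f z) γ)))
      = ε , 0<ε , λ {z′} ball γ≤fz′ → <⇒≱ 0<ε (+-cancelˡ-≤ (f z + (a + b) * ε) (begin
        f z + (a + b) * ε + ε
          ≈⟨ solve 3 (λ u v e → u :+ v :* e :+ e := u :+ (e :+ v :* e)) refl (f z) (a + b) ε ⟩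
        f z + (ε + (a + b) * ε)
          ≈⟨ +-congˡ (+-congʳ (*-identityˡ ε)) ⟨
        f z + (1# * ε + (a + b) * ε)
          ≈⟨ solve 4 (λ u o v e → u :+ (o :* e :+ v :* e) := u :+ (o :+ v) :* e) refl (f z) 1# (a + b) ε ⟩
        f z + (1# + (a + b)) * ε
          ≈⟨ +-congˡ kε≈δ ⟩
        f z + (γ - f z)
          ≈⟨ x+[y-x]≈y (f z) γ ⟩
        γ
          ≤⟨ γ≤fz′ ⟩
        f z′
          ≈⟨ +-congʳ (+-cong (*-congˡ (x+[y-x]≈y (0th z) (0th z′)))
                              (*-congˡ (x+[y-x]≈y (1st z) (1st z′)))) ⟨
        α * (0th z + (0th z′ - 0th z)) + β * (1st z + (1st z′ - 1st z)) + κ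
          ≈⟨ solve 7 (λ α x u β y v κ → α :* (x :+ u) :+ β :* (y :+ v) :+ κ :=
                                       α :* x :+ β :* y :+ κ :+ (α :* u :+ β :* v))
                     refl α (0th z) (0th z′ - 0th z) β (1st z) (1st z′ - 1st z) κ ⟩
        f z + (α * (0th z′ - 0th z) + β * (1st z′ - 1st z))
          ≤⟨ +-monoʳ-≤ (f z) (+-mono-≤
               (a-bound (proj₁ (proj₁ (ball Fin.zero))) (proj₁ (proj₂ (ball Fin.zero))))
               (b-bound (proj₁ (proj₁ (ball (Fin.suc Fin.zero)))) (proj₁ (proj₂ (ball (Fin.suc Fin.zero)))))) ⟩
        f z + (a * ε + b * ε)
          ≈⟨ solve 4 (λ u a b e → u :+ (a :* e :+ b :* e) := u :+ (a :+ b) :* e) refl (f z) a b ε ⟩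
        f z + (a + b) * ε
          ≈⟨ +-identityʳ _ ⟨
        f z + (a + b) * ε + 0# ∎))

    convex : IsConvex ℝ (halfSpace γ α β κ)
    convex z w γ≤fz γ≤fw t 0≤t t≤1 = begin
      -- The solver knows only commutative semiring laws, so `1# - t` enters as a variable `s`, and
      -- `s + t ≈ 1#` is applied by hand at both ends.
      γ
        ≈⟨ s+t≈1* γ ⟨
      (s + t) * γ
        ≈⟨ solve 3 (λ s t g → (s :+ t) :* g := s :* g :+ t :* g) refl s t γ ⟩
      s * γ + t * γ
        ≤⟨ +-mono-≤ (*-monoˡ-≤-nonNeg (x≤y⇒0≤y-x t≤1) γ≤fz) (*-monoˡ-≤-nonNeg 0≤t γ≤fw) ⟩
      s * f z + t * f w
        ≈⟨ solve 9 (λ s t α β κ x y u v →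
             s :* (α :* x :+ β :* y :+ κ) :+ t :* (α :* u :+ β :* v :+ κ) :=
             α :* (s :* x :+ t :* u) :+ β :* (s :* y :+ t :* v) :+ (s :+ t) :* κ)
             refl s t α β κ (0th z) (1st z) (0th w) (1st w) ⟩
      α * (s * 0th z + t * 0th w) + β * (s * 1st z + t * 1st w) + (s + t) * κ
        ≈⟨ +-congˡ (s+t≈1* κ) ⟩
      α * (s * 0th z + t * 0th w) + β * (s * 1st z + t * 1st w) + κ ∎
      where
      s = 1# - t
      s+t≈1* : ∀ x → (s + t) * x ≈ x
      s+t≈1* x = trans (*-congʳ (trans (+-comm s t) (x+[y-x]≈y t 1#))) (*-identityˡ x)

  -- Only the two plane coordinates are bounded here; `U` bounds the others. Written with
  -- half-spaces, the set inherits closedness and convexity.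
  box : ∀ {d} → Carrier → PointSet ℝ (2 ℕ.+ d)
  box r = (halfSpace (- r) 1# 0# 0# Pred.∩ halfSpace (- r) (- 1#) 0# 0#) Pred.∩
          (halfSpace (- r) 0# 1# 0# Pred.∩ halfSpace (- r) 0# (- 1#) 0#)

  box-closedConvex : ∀ {d} r → IsClosedConvexSet (box {d} r)
  box-closedConvex r =
    ∩-closedConvex (∩-closedConvex (half _ _ _ _) (half _ _ _ _))
                   (∩-closedConvex (half _ _ _ _) (half _ _ _ _))
    where half = halfSpace-closedConvex

  InBox : ∀ {d} → Carrier → Point ℝ (2 ℕ.+ d) → Set
  InBox r z = ((- r ≤ 0th z) × (0th z ≤ r)) × ((- r ≤ 1st z) × (1st z ≤ r))

  x+0y+0≈x : ∀ x y → x + 0# * y + 0# ≈ x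
  x+0y+0≈x x y = trans (+-identityʳ _) (trans (+-congˡ (zeroˡ y)) (+-identityʳ x))

  0x+y+0≈y : ∀ x y → 0# * x + y + 0# ≈ y
  0x+y+0≈y x y = trans (+-congʳ (+-comm _ _)) (x+0y+0≈x y x)

  0th-affine : ∀ {d} (z : Point ℝ (2 ℕ.+ d)) → affine 1# 0# 0# z ≈ 0th z
  0th-affine z = trans (x+0y+0≈x _ _) (*-identityˡ _)

  -0th-affine : ∀ {d} (z : Point ℝ (2 ℕ.+ d)) → affine (- 1#) 0# 0# z ≈ - 0th z
  -0th-affine z = trans (x+0y+0≈x _ _) (-1*x≈-x _)

  1st-affine : ∀ {d} (z : Point ℝ (2 ℕ.+ d)) → affine 0# 1# 0# z ≈ 1st z
  1st-affine z = trans (0x+y+0≈y _ _) (*-identityˡ _)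

  -1st-affine : ∀ {d} (z : Point ℝ (2 ℕ.+ d)) → affine 0# (- 1#) 0# z ≈ - 1st z
  -1st-affine z = trans (0x+y+0≈y _ _) (-1*x≈-x _)

  box⇒InBox : ∀ {d r} (z : Point ℝ (2 ℕ.+ d)) → z ∈ box r → InBox r z
  box⇒InBox z ((p , q) , (u , v)) =
    (≤-trans p (≤-reflexive (0th-affine z)) , neg-cancel-≤ (≤-trans q (≤-reflexive (-0th-affine z)))) ,
    (≤-trans u (≤-reflexive (1st-affine z)) , neg-cancel-≤ (≤-trans v (≤-reflexive (-1st-affine z))))

  InBox⇒box : ∀ {d r} (z : Point ℝ (2 ℕ.+ d)) → InBox r z → z ∈ box r
  InBox⇒box z ((p , q) , (u , v)) =
    (≤-trans p (≤-reflexive (sym (0th-affine z))) ,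
     ≤-trans (neg-antimono-≤ q) (≤-reflexive (sym (-0th-affine z)))) ,
    (≤-trans u (≤-reflexive (sym (1st-affine z))) ,
     ≤-trans (neg-antimono-≤ v) (≤-reflexive (sym (-1st-affine z))))

  -- The parabola, its tangents and its caps.

  -- The value at (x , y) is (y − x²) + (x + c)²: the tangent of the
  -- parabola y = x² at (− c , c²) is the zero line.
  tangent : ∀ {d} → Carrier → Point ℝ (2 ℕ.+ d) → Carrier
  tangent c = affine (c + c) 1# (c * c)

  -- Level `0#` gives the side of the tangent containing the parabola. Level `1#` shifts the line up
  -- by one unit, and the part of `aboveParabola` strictly below the shifted line is the cap at (- c
  -- , c²).
  aboveTangent : ∀ {d} → Carrier → Carrier → PointSet ℝ (2 ℕ.+ d)
  aboveTangent γ c = halfSpace γ (c + c) 1# (c * c)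

  tangent-cong : ∀ {d a b} (z : Point ℝ (2 ℕ.+ d)) → a ≈ b → tangent a z ≈ tangent b z
  tangent-cong z a≈b = +-cong (+-congʳ (*-congʳ (+-cong a≈b a≈b))) (*-cong a≈b a≈b)

  -- This is the region y ≥ x²: the tangent with c = - x gives that inequality, and it implies all
  -- the others. As an intersection of half-spaces it is closed and convex at once.
  aboveParabola : ∀ {d} → PointSet ℝ (2 ℕ.+ d)
  aboveParabola = ⋂ Carrier (aboveTangent 0#)

  -- The plane part is the point of tangency for parameter `a`. Placing the sign here keeps
  -- `tangent` free of subtraction, within reach of the semiring solver.
  vertex : ∀ {d} → Carrier → Point ℝ d → Point ℝ (2 ℕ.+ d)
  vertex a x = - a ∷ a * a ∷ x

  tangent-vertex : ∀ {d} c a (x : Point ℝ d) → tangent c (vertex a x) ≈ (c - a) * (c - a)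
  tangent-vertex c a x = begin-equality
    (c + c) * - a + 1# * (a * a) + c * c
      -- Rewriting `a * a` as the square of `- a` lets the solver treat `- a` as a single variable.
      ≈⟨ +-congʳ (+-congˡ (trans (*-identityˡ _) (sym (-x*-y≈x*y a a)))) ⟩
    (c + c) * - a + - a * - a + c * c
      ≈⟨ solve 2 (λ c n → (c :+ c) :* n :+ n :* n :+ c :* c := (c :+ n) :* (c :+ n)) refl c (- a) ⟩
    (c - a) * (c - a) ∎

  vertex-aboveParabola : ∀ {d} a (x : Point ℝ d) → vertex a x ∈ aboveParabola
  vertex-aboveParabola a x c =
    ≤-trans (square-nonNeg (c - a)) (≤-reflexive (sym (tangent-vertex c a x)))

  vertex-belowTangent : ∀ {d} a (x : Point ℝ d) → ¬ (vertex a x ∈ aboveTangent 1# a)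
  vertex-belowTangent a x 1≤ = 1≰0 (begin
    1#                      ≤⟨ 1≤ ⟩
    tangent a (vertex a x)  ≈⟨ tangent-vertex a a x ⟩
    (a - a) * (a - a)       ≈⟨ *-congʳ (-‿inverseʳ a) ⟩
    0# * (a - a)            ≈⟨ zeroˡ (a - a) ⟩
    0#                      ∎)

  -- The sum of the tangents at 2a and 2b is 2 (b − a)² plus twice the
  -- tangent at the midpoint a + b.
  caps-disjoint : ∀ {d a b e} (z : Point ℝ (2 ℕ.+ d)) → 1# ≤ e → a + e ≈ b → z ∈ aboveParabola →
                  ¬ (z ∈ aboveTangent 1# (a + a)) → ¬ (z ∈ aboveTangent 1# (b + b)) → ⊥
  caps-disjoint {a = a} {b} {e} z 1≤e a+e≈b z∈P z∉a z∉b = z∉b (+-cancelˡ-≤ 1# (begin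
    1# + 1#
      ≤⟨ +-mono-≤ (1≤x⇒1≤x² 1≤e) (1≤x⇒1≤x² 1≤e) ⟩
    e * e + e * e
      ≤⟨ x≤y+x (+-nonNeg (z∈P (a + (a + e))) (z∈P (a + (a + e)))) ⟩
    tangent (a + (a + e)) z + tangent (a + (a + e)) z + (e * e + e * e)
      ≈⟨ solve 5 (λ a e x o y →
           let ℓ = λ c → (c :+ c) :* x :+ o :* y :+ c :* c in
           ℓ (a :+ (a :+ e)) :+ ℓ (a :+ (a :+ e)) :+ (e :* e :+ e :* e) :=
           ℓ (a :+ a) :+ ℓ ((a :+ e) :+ (a :+ e)))
           refl a e (0th z) 1# (1st z) ⟩
    tangent (a + a) z + tangent ((a + e) + (a + e)) z
      ≤⟨ +-mono-≤ (≰⇒≥ z∉a) (≤-reflexive (tangent-cong z (+-cong a+e≈b a+e≈b))) ⟩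
    1# + tangent (b + b) z ∎))

-- Numbering the subsets.

-- The membership bits are read as a binary numeral. Injectivity separates the slopes, and the
-- finite range yields `radius-bound`.
encode : ∀ {n} → Subset n → Fin (2 ℕ.^ n)
encode Vec.[]      = Fin.zero
encode (b Vec.∷ σ) = combine (Inverse.from 2↔Bool b) (encode σ)

encode-injective : ∀ {n} (σ τ : Subset n) → encode σ ≡ encode τ → σ ≡ τ
encode-injective Vec.[]      Vec.[]      _  = ≡.refl
encode-injective (a Vec.∷ σ) (b Vec.∷ τ) eq
  with a≡b , σ≡τ ← combine-injective _ (encode σ) _ (encode τ) eq =
  ≡.cong₂ Vec._∷_ (Injection.injective (↔⇒↣ (↔-sym 2↔Bool)) a≡b) (encode-injective σ τ σ≡τ)

-- The realization of `C ∪ D`.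

module Realization (em : ExcludedMiddle (suc 0ℓ)) (ℝ : CompleteOrderedField)
                   {n : ℕ} {C D : Code n} (D-down : IsDownwardClosedIn (Δ C ∖ C) D)
                   {d : ℕ} (C-real : ClosedConvexRealization ℝ C d) where
  open OrderedField ℝ
  open Geometry em ℝ
  open SemiringMultiplication semiring using (×-homo-+; ×-congˡ) renaming (_×_ to _·_)
  open IsDownwardClosedIn D-down
  open ClosedConvexRealization C-real renaming (sets to U)

  codeword : (Q : Fin n → Set) → ∃ λ σ → ∀ i → Q i ⇔ (i Subset.∈ σ)
  codeword Q = σ , λ i → mk⇔ (to i) (from i)
    where
    σ : Subset n
    σ = Vec.tabulate (λ i → does (decide {Q i}))

    to : ∀ i → Q i → i Subset.∈ σ
    to i q = lookup⇒[]= i σ (≡.trans (lookup∘tabulate _ i) (dec-true decide q))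

    from : ∀ i → i Subset.∈ σ → Q i
    from i i∈σ = decidable-stable decide λ ¬q → true≢false
      (≡.trans (≡.sym ([]=⇒lookup i∈σ)) (≡.trans (lookup∘tabulate _ i) (dec-false decide ¬q)))
      where
      true≢false : true ≢ false
      true≢false ()

  -- A point whose coordinates exceed the bounds of all the sets lies in none of them; `1≤d`
  -- supplies a coordinate in which this shows.
  ⊥∈C : Subset.⊥ ∈ C
  ⊥∈C with b , bound ← finite-bound (proj₁ ∘ bounded) = proj₁ code-sets ((λ _ → 1# + b) , λ i → mk⇔
    (λ x∈Ui → ⊥-elim (1+x≰x (≤-trans (proj₂ (proj₂ (bounded i) _ x∈Ui (Fin.fromℕ< 1≤d))) (bound i))))
    (λ i∈⊥ → ⊥-elim (Subset.∉⊥ i∈⊥)))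

  ·1-nonNeg : ∀ m → 0# ≤ m · 1#
  ·1-nonNeg ℕ.zero    = ≤-refl
  ·1-nonNeg (ℕ.suc m) = +-nonNeg 0≤1 (·1-nonNeg m)

  ·1-gap : ∀ {m k} → m ℕ.< k → ∃ λ e → (1# ≤ e) × (m · 1# + e ≈ k · 1#)
  ·1-gap {m} {k} m<k = ℕ.suc o · 1# , x≤x+y (·1-nonNeg o) , (begin-equality
    m · 1# + ℕ.suc o · 1# ≈⟨ ×-homo-+ 1# m (ℕ.suc o) ⟨
    (m ℕ.+ ℕ.suc o) · 1#  ≈⟨ ×-congˡ (≡.trans (ℕ.+-suc m o) (ℕ.m+[n∸m]≡n m<k)) ⟩
    k · 1#                ∎)
    where o = k ℕ.∸ ℕ.suc m

  -- A cap at (- c , c²) satisfies (x + c)² < 1, so parameters two apart give disjoint caps. The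
  -- form `a + a` also provides midpoints without halving, as `caps-disjoint` requires.
  double : Fin (2 ℕ.^ n) → Carrier
  double j = toℕ j · 1# + toℕ j · 1#

  -- This is the parameter of `tangent`; the line itself has slope -2 times it. Members of `C` get
  -- one too, since they are realized at their own vertices.
  slope : Subset n → Carrier
  slope σ = double (encode σ)

  slope-nonNeg : ∀ σ → 0# ≤ slope σ
  slope-nonNeg σ = +-nonNeg (·1-nonNeg (toℕ (encode σ))) (·1-nonNeg (toℕ (encode σ)))

  apex : Subset n → Point ℝ d → Point ℝ (2 ℕ.+ d)
  apex σ = vertex (slope σ)

  cap-unique : ∀ (z : Point ℝ (2 ℕ.+ d)) {σ τ} → z ∈ aboveParabola →
               ¬ (z ∈ aboveTangent 1# (slope σ)) → ¬ (z ∈ aboveTangent 1# (slope τ)) → σ ≡ τ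
  cap-unique z {σ} {τ} z∈P z∉σ z∉τ with ℕ.<-cmp (toℕ (encode σ)) (toℕ (encode τ))
  ... | tri≈ _ eq _ = encode-injective σ τ (toℕ-injective eq)
  ... | tri< lt _ _ with e , 1≤e , eq ← ·1-gap lt = ⊥-elim (caps-disjoint z 1≤e eq z∈P z∉σ z∉τ)
  ... | tri> _ _ gt with e , 1≤e , eq ← ·1-gap gt = ⊥-elim (caps-disjoint z 1≤e eq z∈P z∉τ z∉σ)

  -- Both summands are nonnegative, so bounding the sum bounds both plane coordinates of every
  -- vertex.
  radius-bound : ∃ λ r → ∀ j → double j + double j * double j ≤ r
  radius-bound = finite-bound (λ j → double j + double j * double j)

  radius : Carrier
  radius = proj₁ radius-bound

  slope≤radius : ∀ σ → slope σ ≤ radius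
  slope≤radius σ = ≤-trans (x≤x+y (square-nonNeg _)) (proj₂ radius-bound (encode σ))

  slope²≤radius : ∀ σ → slope σ * slope σ ≤ radius
  slope²≤radius σ = ≤-trans (x≤y+x (slope-nonNeg σ)) (proj₂ radius-bound (encode σ))

  apex-inBox : ∀ σ x → InBox radius (apex σ x)
  apex-inBox σ x = (-r≤-s , ≤-trans -s≤0 0≤r) , (≤-trans -r≤-s (≤-trans -s≤0 (square-nonNeg _)) , slope²≤radius σ)
    where
    -r≤-s = neg-antimono-≤ (slope≤radius σ)
    -s≤0  = nonNeg⇒neg-nonPos (slope-nonNeg σ)
    0≤r   = ≤-trans (slope-nonNeg σ) (slope≤radius σ)

  frame : PointSet ℝ (2 ℕ.+ d)
  frame = box radius Pred.∩ aboveParabola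

  Missing : Fin n → Set
  Missing i = ∃ λ τ → (τ ∈ D) × ¬ (i Subset.∈ τ)

  -- Inside `frame`, passing to the half-space above the line of a cap removes exactly that cap, so
  -- removal preserves closedness and convexity.
  uncapped : Fin n → PointSet ℝ (2 ℕ.+ d)
  uncapped i = ⋂ (Missing i) λ (τ , _) → aboveTangent 1# (slope τ)

  V : Fin n → PointSet ℝ (2 ℕ.+ d)
  V i = (tail² ⊢ U i) Pred.∩ (frame Pred.∩ uncapped i)

  V-closedConvex : ∀ i → IsClosedConvexSet (V i)
  V-closedConvex i = ∩-closedConvex (tail²-closedConvex (closed i , convex i))
    (∩-closedConvex
      (∩-closedConvex (box-closedConvex radius) (⋂-closedConvex λ _ → halfSpace-closedConvex _ _ _ _))
      (⋂-closedConvex λ _ → halfSpace-closedConvex _ _ _ _))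

  V-bounded : ∀ i → IsBounded ℝ (V i)
  V-bounded i with a , U-bound ← bounded i
              with b , a≤b , r≤b ← upper-bound a radius = b , bound
    where
    bound : ∀ z → z ∈ V i → ∀ j → (- b ≤ z j) × (z j ≤ b)
    bound z (z∈U , (z∈box , _) , _) = split
      where
      widen : ∀ {c y} → c ≤ b → (- c ≤ y) × (y ≤ c) → (- b ≤ y) × (y ≤ b)
      widen c≤b (-c≤y , y≤c) = ≤-trans (neg-antimono-≤ c≤b) -c≤y , ≤-trans y≤c c≤b

      split : ∀ j → (- b ≤ z j) × (z j ≤ b)
      split Fin.zero              = widen r≤b (proj₁ (box⇒InBox z z∈box))
      split (Fin.suc Fin.zero)    = widen r≤b (proj₂ (box⇒InBox z z∈box))
      split (Fin.suc (Fin.suc j)) = widen a≤b (U-bound _ z∈U j)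

  code-V⊆C∪D : code ℝ V ⊆ C ∪ D
  code-V⊆C∪D {σ} (z , z↔σ) with decide {z ∈ frame}
  ... | no z∉frame = inj₁ (≡.subst C (≡.sym σ≡⊥) ⊥∈C)
    where
    σ≡⊥ : σ ≡ Subset.⊥
    σ≡⊥ = Empty-unique λ (i , i∈σ) → z∉frame (proj₁ (proj₂ (Equivalence.from (z↔σ i) i∈σ)))
  ... | yes z∈frame with ρ , x↔ρ ← codeword (λ i → tail² z ∈ U i)
                   with decide {∃ λ τ → (τ ∈ D) × ¬ (z ∈ aboveTangent 1# (slope τ))}
  -- Outside every cap of `D` the plane factor excludes no index, so the codeword is that of
  -- `tail² z`.
  ...   | no noCap = inj₁ (≡.subst C (⊆-antisym ρ⊆σ σ⊆ρ) ρ∈C)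
    where
    ρ∈C = proj₁ code-sets (tail² z , x↔ρ)
    ρ⊆σ : ρ Subset.⊆ σ
    ρ⊆σ {i} i∈ρ = Equivalence.to (z↔σ i)
      (Equivalence.from (x↔ρ i) i∈ρ , z∈frame ,
       λ (τ , τ∈D , _) → decidable-stable decide λ z∉τ → noCap (τ , τ∈D , z∉τ))
    σ⊆ρ : σ Subset.⊆ ρ
    σ⊆ρ {i} i∈σ = Equivalence.to (x↔ρ i) (proj₁ (Equivalence.from (z↔σ i) i∈σ))
  ...   | yes (τ , τ∈D , z∉τ) with decide {σ ∈ C}
  ...     | yes σ∈C = inj₁ σ∈C
  -- Here `σ ⊆ ρ` places `σ` in `Δ C`. The cap of `τ` is cut from every `V i` with `i` outside `τ`,
  -- whence `σ ⊆ τ` and `down` applies.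
  ...     | no σ∉C = inj₂ (down τ∈D ((ρ , proj₁ code-sets (tail² z , x↔ρ) , σ⊆ρ) , σ∉C) σ⊆τ)
    where
    σ⊆ρ : σ Subset.⊆ ρ
    σ⊆ρ {i} i∈σ = Equivalence.to (x↔ρ i) (proj₁ (Equivalence.from (z↔σ i) i∈σ))
    σ⊆τ : σ Subset.⊆ τ
    σ⊆τ {i} i∈σ = decidable-stable decide λ i∉τ →
      z∉τ (proj₂ (proj₂ (Equivalence.from (z↔σ i) i∈σ)) (τ , τ∈D , i∉τ))

  apex∈frame : ∀ σ x → apex σ x ∈ frame
  apex∈frame σ x = InBox⇒box (apex σ x) (apex-inBox σ x) , vertex-aboveParabola (slope σ) x

  -- The vertex lies in its own cap, hence in no other; a cap cut from `V i` belongs to some `τ`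
  -- without `i`, so it is not the cap of `σ`.
  apex∈uncapped : ∀ σ x {i} → i Subset.∈ σ → apex σ x ∈ uncapped i
  apex∈uncapped σ x {i} i∈σ (τ , _ , i∉τ) = decidable-stable decide λ z∉τ →
    i∉τ (≡.subst (i Subset.∈_)
      (cap-unique (apex σ x) (vertex-aboveParabola (slope σ) x) (vertex-belowTangent (slope σ) x) z∉τ) i∈σ)

  C∪D⊆code-V : C ∪ D ⊆ code ℝ V
  C∪D⊆code-V {σ} (inj₁ σ∈C) with x , x↔σ ← proj₂ code-sets σ∈C = apex σ x , λ i → mk⇔
    (λ (x∈U , _) → Equivalence.to (x↔σ i) x∈U)
    (λ i∈σ → Equivalence.from (x↔σ i) i∈σ , apex∈frame σ x , apex∈uncapped σ x i∈σ)
  -- The point `x` realizes a larger codeword `ρ`; the surplus indices are lost because the cap of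
  -- `σ` is cut from their sets.
  C∪D⊆code-V {σ} (inj₂ σ∈D) with (ρ , ρ∈C , σ⊆ρ) , _ ← subset σ∈D
                            with x , x↔ρ ← proj₂ code-sets ρ∈C = apex σ x , λ i → mk⇔
    (λ (_ , _ , z∈uncapped) → decidable-stable decide λ i∉σ →
      vertex-belowTangent (slope σ) x (z∈uncapped (σ , σ∈D , i∉σ)))
    (λ i∈σ → Equivalence.from (x↔ρ i) (σ⊆ρ i∈σ) , apex∈frame σ x , apex∈uncapped σ x i∈σ)

  realization : ClosedConvexRealization ℝ (C ∪ D) (2 ℕ.+ d)
  realization = record
    { 1≤d       = ℕ.s≤s ℕ.z≤n
    ; sets      = V
    ; bounded   = V-bounded
    ; closed    = proj₁ ∘ V-closedConvex
    ; convex    = proj₂ ∘ V-closedConvex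
    ; code-sets = code-V⊆C∪D , C∪D⊆code-V
    }

-- The bound on the dimension.

-- Shifting the least element of `P` gives an element of `Q`, which bounds the minimum of `Q`; an
-- empty `P` makes the right-hand side `⊤⁺`.
min∞-shift : ∀ (em : ExcludedMiddle (suc 0ℓ)) {P Q : Pred ℕ (suc 0ℓ)} k →
             (∀ m → P m → Q (m ℕ.+ k)) → min∞ em Q ≤∞ min∞ em P +∞ k
min∞-shift em {P} {Q} k shift with em {Pred.Satisfiable P} | em {Pred.Satisfiable Q}
... | no _   | _      = _ AddSupremum.≤⊤⁺
... | yes ∃P | yes ∃Q = AddSupremum.[ proj₂ (proj₂ (minimum em Q ∃Q)) _ (shift _ (proj₁ (proj₂ (minimum em P ∃P)))) ]
... | yes (m , Pm) | no ∄Q = ⊥-elim (∄Q (m ℕ.+ k , shift m Pm))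

theorem17 : (em : ExcludedMiddle (suc 0ℓ)) (ℝ : CompleteOrderedField) (n : ℕ) (C D : Code n) →
    IsClosedConvex ℝ C →
    IsDownwardClosedIn (Δ C ∖ C) D →
    IsClosedConvex ℝ (C ∪ D) × (cdim em ℝ (C ∪ D) ≤∞ cdim em ℝ C +∞ 2)
theorem17 em ℝ n C D (d , C-real) D-down =
  (d ℕ.+ 2 , extend d C-real) , min∞-shift em 2 extend
  where
  -- Stated for every `m`, since the bound needs it at the minimal dimension and not just at the
  -- given `d`.
  extend : ∀ m → ClosedConvexRealization ℝ C m → ClosedConvexRealization ℝ (C ∪ D) (m ℕ.+ 2)
  extend m real = ≡.subst (ClosedConvexRealization ℝ (C ∪ D)) (ℕ.+-comm 2 m)
                    (Realization.realization em ℝ D-down real)
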